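{- Let $p$ be the partially ordered pattern of length 5 whose occurrences in a permutation $\pi=\pi_1\cdots\pi_n$ are the subsequences $\pi_{i_1}\pi_{i_2}\pi_{i_3}\pi_{i_4}\pi_{i_5}$ with $i_1<i_2<i_3<i_4<i_5$ such that each of $\pi_{i_1},\pi_{i_4}$ is larger than each of $\pi_{i_2},\pi_{i_3},\pi_{i_5}$ (i.e. the complete bipartite pattern $(\{1,4\}/\{2,3,5\})$). Let $a(n)$ be the number of permutations of $[n]$ avoiding $p$ (with $a(0)=1$). Define $b(1)=0$, $b(2)=1$ and, for $n\geq 3$, $$b(n)=a(n-2)+b(n-1)+2\sum_{i=2}^{n-2}b(i).$$ Then $a(n)=n!$ for $n\leq 4$, and for $n\geq 5$, $$a(n)=7a(n-1)-12a(n-2)+4a(n-3)+2b(n-2).$$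
   Context: A permutation avoids a pattern if it contains no occurrence of it. -}

module Defs where

open import Data.Nat using (ℕ; zero; suc; _+_; _∸_)
open import Data.Fin using (Fin; _<_)
open import Data.Fin.Properties using (any?; all?; _<?_; _≟_)
open import Data.Vec using (Vec; []; _∷_; lookup)
open import Data.List using (List; []; _∷_; [_]; map; concatMap; length; filter; upTo)
open import Data.Nat.ListAction using (sum)
open import Data.List using () renaming (allFin to allFinL)
open import Data.Product using (_×_; ∃-syntax)
open import Relation.Nullary using (¬_; Dec; ¬?; _×-dec_; _→-dec_)
open import Relation.Binary.PropositionalEquality using (_≡_)

IsPerm : ∀ {n} → Vec (Fin n) n → Set
IsPerm {n} π = (i j : Fin n) → lookup π i ≡ lookup π j → i ≡ j

isPerm? : ∀ {n} (π : Vec (Fin n) n) → Dec (IsPerm π)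
isPerm? π = all? λ i → all? λ j → (lookup π i ≟ lookup π j) →-dec (i ≟ j)

Occurrence : ∀ {n} → Vec (Fin n) n → (i₁ i₂ i₃ i₄ i₅ : Fin n) → Set
Occurrence π i₁ i₂ i₃ i₄ i₅ =
  (i₁ < i₂ × i₂ < i₃ × i₃ < i₄ × i₄ < i₅) ×
  (lookup π i₂ < lookup π i₁ × lookup π i₃ < lookup π i₁ × lookup π i₅ < lookup π i₁) ×
  (lookup π i₂ < lookup π i₄ × lookup π i₃ < lookup π i₄ × lookup π i₅ < lookup π i₄)

Contains : ∀ {n} → Vec (Fin n) n → Set
Contains π = ∃[ i₁ ] ∃[ i₂ ] ∃[ i₃ ] ∃[ i₄ ] ∃[ i₅ ] Occurrence π i₁ i₂ i₃ i₄ i₅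

Avoids : ∀ {n} → Vec (Fin n) n → Set
Avoids π = ¬ Contains π

occurrence? : ∀ {n} (π : Vec (Fin n) n) i₁ i₂ i₃ i₄ i₅ → Dec (Occurrence π i₁ i₂ i₃ i₄ i₅)
occurrence? π i₁ i₂ i₃ i₄ i₅ =
  ((i₁ <? i₂) ×-dec (i₂ <? i₃) ×-dec (i₃ <? i₄) ×-dec (i₄ <? i₅)) ×-dec
  ((lookup π i₂ <? lookup π i₁) ×-dec (lookup π i₃ <? lookup π i₁) ×-dec (lookup π i₅ <? lookup π i₁)) ×-dec
  ((lookup π i₂ <? lookup π i₄) ×-dec (lookup π i₃ <? lookup π i₄) ×-dec (lookup π i₅ <? lookup π i₄))

avoids? : ∀ {n} (π : Vec (Fin n) n) → Dec (Avoids π)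
avoids? π = ¬? (any? λ i₁ → any? λ i₂ → any? λ i₃ → any? λ i₄ → any? λ i₅ → occurrence? π i₁ i₂ i₃ i₄ i₅)

allVecs : (k n : ℕ) → List (Vec (Fin n) k)
allVecs zero    n = [ [] ]
allVecs (suc k) n = concatMap (λ x → map (x ∷_) (allVecs k n)) (allFinL n)

a : ℕ → ℕ
a n = length (filter (λ π → isPerm? π ×-dec avoids? π) (allVecs n n))

-- Σ_{i=2}^{m} b(i)  (empty sum when m < 2)
sum2to : (ℕ → ℕ) → ℕ → ℕ
sum2to b m = sum (map (λ k → b (2 + k)) (upTo (m ∸ 1)))

{-# OPTIONS --safe #-}
-- Build permutations by successive insertion of a new maximum, and call a slot of σ active if inserting there
-- yields an avoider.  Two maximal letters can only occur together as the 1 and the 4 of the pattern, so after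
-- inserting a maximum at an active slot k, a slot j stays active iff it was active before and the two maxima are
-- at distance at most two or one of them is last.  Hence the word of active slots evolves as an automaton.
-- Apart from irrelevant inactive slots a reachable word is a final run of active slots, possibly preceded by a
-- separate cluster of three or four of them, and the number of descendants depends on the length of the final
-- run (once it is at least four) and on the cluster only through additive corrections.  This gives a finite
-- linear system for a(n), from which the recurrence and a closed expression for b(n) follow.
module Submission where

open import Defs
open import Data.Nat using (ℕ; _+_; _*_; _≤_; _!)
open import Data.Integer using (ℤ; +_) renaming (_+_ to _+ℤ_; _-_ to _-ℤ_; _*_ to _*ℤ_)
open import Data.Product using (_×_)
open import Relation.Binary.PropositionalEquality using (_≡_)
open import Data.Bool using (Bool; true; false; T; _∧_; if_then_else_)
open import Data.Bool.Properties using (T?; ∧-identityʳ; ∧-zeroʳ)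
open import Data.Fin using (Fin; zero; suc; toℕ; fromℕ; fromℕ<; inject₁; lower₁; punchIn; punchOut; pinch; _<_)
open import Data.Fin.Properties using (_≟_; any?; pigeonhole; toℕ<n; toℕ≤pred[n]; toℕ-fromℕ; toℕ-fromℕ<; toℕ-inject₁; toℕ-injective; punchIn-punchOut; punchInᵢ≢i; punchIn-injective; punchIn-mono-≤; punchIn-cancel-≤; inject₁-injective; inject₁-lower₁; lower₁-injective; fromℕ≢inject₁)
import Data.Integer.Properties as ℤ
import Data.Integer.Tactic.RingSolver as ℤ-Solver
open import Data.List using (List; []; _∷_; [_]; map; _++_; concatMap; length; filter; tabulate; allFin; cartesianProduct; replicate; upTo)
open import Data.List.Membership.Propositional using (_∈_)
open import Data.List.Membership.Propositional.Properties using (∈-map⁺; ∈-map⁻; ∈-filter⁺; ∈-filter⁻; ∈-cartesianProduct⁺; ∈-cartesianProduct⁻; ∈-allFin)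
open import Data.List.Membership.Propositional.Properties.WithK using (unique∧set⇒bag)
open import Data.List.Properties using (tabulate-cong; map-tabulate; map-∘; map-++; map-cong; upTo-∷ʳ)
open import Data.List.Relation.Binary.BagAndSetEquality using (∼bag⇒↭)
open import Data.List.Relation.Binary.Permutation.Propositional.Properties using (↭-length)
open import Data.List.Relation.Unary.All using ([])
open import Data.List.Relation.Unary.AllPairs using ([]; _∷_)
open import Data.List.Relation.Unary.Any using (here)
open import Data.List.Relation.Unary.Unique.Propositional using (Unique)
import Data.List.Relation.Unary.Unique.Propositional.Properties as Unique
open import Data.Nat using (zero; suc; s≤s; z≤n; s<s; s<s⁻¹)
import Data.Nat as ℕ
open import Data.Nat.ListAction using (sum)
open import Data.Nat.ListAction.Properties using (sum-++)
import Data.Nat.Properties as ℕ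
open import Data.Nat.Tactic.RingSolver using (solve-∀)
open import Data.Product using (_,_; proj₁; proj₂; ∃-syntax; swap; uncurry)
open import Data.Sum using (_⊎_; inj₁; inj₂; [_,_]′)
open import Data.Unit using (tt)
open import Data.Vec using (Vec; lookup; insertAt)
import Data.Vec as Vec
import Data.Vec.Properties as Vec
open import Function using (_∘_; id; _⇔_; mk⇔; Equivalence)
open import Relation.Nullary using (¬_; Dec; yes; no; does; contradiction; _×-dec_)
open import Relation.Nullary.Decidable using (does-⇔)
open import Relation.Binary.PropositionalEquality using (_≢_; _≗_; refl; sym; trans; cong; cong₂; subst; subst₂; ≢-sym; module ≡-Reasoning)

private variable
  m n : ℕ
  A B : Set

-- Pattern containment in words

-- Patterns in ℕ-valued words: their order is all that matters, so letters need not form an initial segment.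
OccursIn : (Fin n → ℕ) → (i₁ i₂ i₃ i₄ i₅ : Fin n) → Set
OccursIn w i₁ i₂ i₃ i₄ i₅ =
  (i₁ < i₂ × i₂ < i₃ × i₃ < i₄ × i₄ < i₅) ×
  (w i₂ ℕ.< w i₁ × w i₃ ℕ.< w i₁ × w i₅ ℕ.< w i₁) ×
  (w i₂ ℕ.< w i₄ × w i₃ ℕ.< w i₄ × w i₅ ℕ.< w i₄)

ContainedIn : (Fin n → ℕ) → Set
ContainedIn w = ∃[ i₁ ] ∃[ i₂ ] ∃[ i₃ ] ∃[ i₄ ] ∃[ i₅ ] OccursIn w i₁ i₂ i₃ i₄ i₅

word : Vec (Fin n) m → Fin m → ℕ
word π = toℕ ∘ lookup π

contained-∘ : {w : Fin n → ℕ} (e : Fin m → Fin n) → (∀ {i j} → i < j → e i < e j) →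
              ContainedIn (w ∘ e) → ContainedIn w
contained-∘ e mono (i₁ , i₂ , i₃ , i₄ , i₅ , (p , q , r , s) , vs) =
  e i₁ , e i₂ , e i₃ , e i₄ , e i₅ , (mono p , mono q , mono r , mono s) , vs

-- An occurrence only demands that certain strict inequalities hold, so implications in one
-- direction are enough.
contained-reorder : {u v : Fin n → ℕ} → (∀ i j → u i ℕ.< u j → v i ℕ.< v j) →
                    ContainedIn u → ContainedIn v
contained-reorder f (i₁ , i₂ , i₃ , i₄ , i₅ , ps , (p , q , r) , (s , t , v)) =
  i₁ , i₂ , i₃ , i₄ , i₅ , ps , (f _ _ p , f _ _ q , f _ _ r) , (f _ _ s , f _ _ t , f _ _ v)

punchIn-mono-< : ∀ (p : Fin (suc n)) {i j : Fin n} → i < j → punchIn p i < punchIn p j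
punchIn-mono-< p i<j = ℕ.≰⇒> (ℕ.<⇒≱ i<j ∘ punchIn-cancel-≤ p _ _)

punchIn-cancel-< : ∀ (p : Fin (suc n)) {i j : Fin n} → punchIn p i < punchIn p j → i < j
punchIn-cancel-< p lt = ℕ.≰⇒> (ℕ.<⇒≱ lt ∘ punchIn-mono-≤ p _ _)

contained-punchIn : ∀ {w : Fin (suc n) → ℕ} p → ContainedIn (w ∘ punchIn p) → ContainedIn w
contained-punchIn p = contained-∘ (punchIn p) (punchIn-mono-< p)

punched : ∀ {p i : Fin (suc n)} → p ≢ i → ∃[ j ] punchIn p j ≡ i
punched p≢i = punchOut p≢i , punchIn-punchOut p≢i

contained-punchOut : ∀ {w : Fin (suc n) → ℕ} p {i₁ i₂ i₃ i₄ i₅} → OccursIn w i₁ i₂ i₃ i₄ i₅ →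
  p ≢ i₁ → p ≢ i₂ → p ≢ i₃ → p ≢ i₄ → p ≢ i₅ → ContainedIn (w ∘ punchIn p)
contained-punchOut p ((r₁ , r₂ , r₃ , r₄) , vs) n₁ n₂ n₃ n₄ n₅
  with j₁ , refl ← punched n₁ | j₂ , refl ← punched n₂ | j₃ , refl ← punched n₃
     | j₄ , refl ← punched n₄ | j₅ , refl ← punched n₅
  = j₁ , j₂ , j₃ , j₄ , j₅ ,
    (punchIn-cancel-< p r₁ , punchIn-cancel-< p r₂ , punchIn-cancel-< p r₃ , punchIn-cancel-< p r₄) , vs

-- Two maximal letters at positions x before y play the roles of i₁ and i₄ of an occurrence.
Far : (x y : Fin (suc n)) → Set
Far {n} x y = 3 + toℕ x ≤ toℕ y × toℕ y ℕ.< n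

-- The order between the two top letters is left open, matching the pattern, which does not compare
-- its first and fourth letters.
DominatedBy : (Fin n → ℕ) → (x y : Fin n) → Set
DominatedBy w x y = ∀ i → i ≢ x → i ≢ y → w i ℕ.< w x × w i ℕ.< w y

dominated-sym : ∀ {w : Fin n → ℕ} {x y} → DominatedBy w x y → DominatedBy w y x
dominated-sym dom i i≢y i≢x = swap (dom i i≢x i≢y)

dominator-above : ∀ {w : Fin n → ℕ} {x y i} → DominatedBy w x y → w x ℕ.< w i → i ≡ y
dominator-above {x = x} {y} {i} dom wx<wi with i ≟ x | i ≟ y
... | _        | yes i≡y = i≡y
... | yes refl | no _    = contradiction wx<wi (ℕ.<-irrefl refl)
... | no i≢x   | no i≢y  = contradiction wx<wi (ℕ.<-asym (proj₁ (dom i i≢x i≢y)))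

-- A small letter of an occurrence has two distinct letters above it, whereas only `y` can lie above
-- the dominator `x`.
dominator-not-small : ∀ {w : Fin n → ℕ} {x y i j s} → DominatedBy w x y → i < j →
                      w s ℕ.< w i → w s ℕ.< w j → x ≢ s
dominator-not-small dom i<j s<i s<j refl
  with refl ← dominator-above dom s<i | refl ← dominator-above dom s<j = ℕ.<-irrefl refl i<j

-- A dominating letter can only serve as `i₁` or `i₄`. If one of the two dominators fills neither
-- role, it can be deleted without destroying the occurrence; otherwise they fill both roles.
contained-dominated⁻ : ∀ {w : Fin (suc n) → ℕ} {x y} → x ≢ y → DominatedBy w x y → ContainedIn w →
  ContainedIn (w ∘ punchIn x) ⊎ ContainedIn (w ∘ punchIn y) ⊎ (Far x y ⊎ Far y x)
contained-dominated⁻ {w = w} {x} {y} x≢y dom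
  (i₁ , i₂ , i₃ , i₄ , i₅ , occ@((p , q , r , s) , (l₂ , l₃ , l₅) , (h₂ , h₃ , h₅))) = split
  where
  i₁<i₄ : i₁ < i₄
  i₁<i₄ = ℕ.<-trans p (ℕ.<-trans q r)

  remove : ∀ {x y} → DominatedBy w x y → x ≢ i₁ → x ≢ i₄ → ContainedIn (w ∘ punchIn x)
  remove dom n₁ n₄ = contained-punchOut {w = w} _ occ n₁ (small l₂ h₂) (small l₃ h₃) n₄ (small l₅ h₅)
    where
    small : ∀ {s} → w s ℕ.< w i₁ → w s ℕ.< w i₄ → _ ≢ s
    small = dominator-not-small dom i₁<i₄

  -- `i₂` and `i₃` lie strictly between, which forces distance three; `i₅` shows that `i₄` is not
  -- last.
  far : Far i₁ i₄
  far = ℕ.≤-trans (s≤s (s≤s p)) (ℕ.≤-trans (s≤s q) r) , ℕ.<-≤-trans s (toℕ≤pred[n] i₅)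

  split : ContainedIn (w ∘ punchIn x) ⊎ ContainedIn (w ∘ punchIn y) ⊎ (Far x y ⊎ Far y x)
  split with x ≟ i₁ | x ≟ i₄ | y ≟ i₁ | y ≟ i₄
  ... | yes refl | _        | _        | yes refl = inj₂ (inj₂ (inj₁ far))
  ... | yes refl | _        | _        | no n₄    = inj₂ (inj₁ (remove (dominated-sym dom) (≢-sym x≢y) n₄))
  ... | no _     | yes refl | yes refl | _        = inj₂ (inj₂ (inj₂ far))
  ... | no _     | yes refl | no n₁    | _        = inj₂ (inj₁ (remove (dominated-sym dom) n₁ (≢-sym x≢y)))
  ... | no n₁    | no n₄    | _        | _        = inj₁ (remove dom n₁ n₄)

-- The small letters can be taken at the two positions right after `x` and at the last position of
-- the word.
far⇒contained : ∀ {w : Fin (suc n) → ℕ} {x y} → DominatedBy w x y → Far x y → ContainedIn w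
far⇒contained {n} {w} {x} {y} dom (x+3≤y , y<n) =
  x , x₁ , x₂ , y , fromℕ n ,
  (x<x₁ , x₁<x₂ , x₂<y , y<last) ,
  (proj₁ d₁ , proj₁ d₂ , proj₁ d₃) , (proj₂ d₁ , proj₂ d₂ , proj₂ d₃)
  where
  y<1+n : toℕ y ℕ.< suc n
  y<1+n = toℕ<n y
  b₂ : 2 + toℕ x ℕ.< suc n
  b₂ = ℕ.≤-<-trans (ℕ.<⇒≤ x+3≤y) y<1+n
  b₁ : 1 + toℕ x ℕ.< suc n
  b₁ = ℕ.<-trans (ℕ.n<1+n _) b₂
  x₁ x₂ : Fin (suc n)
  x₁ = fromℕ< b₁
  x₂ = fromℕ< b₂
  x<x₁ : x < x₁
  x<x₁ rewrite toℕ-fromℕ< b₁ = ℕ.≤-refl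
  x₁<x₂ : x₁ < x₂
  x₁<x₂ rewrite toℕ-fromℕ< b₁ | toℕ-fromℕ< b₂ = ℕ.≤-refl
  x₂<y : x₂ < y
  x₂<y rewrite toℕ-fromℕ< b₂ = x+3≤y
  y<last : y < fromℕ n
  y<last rewrite toℕ-fromℕ n = y<n
  <⇒≢ : ∀ {i j : Fin (suc n)} → i < j → i ≢ j
  <⇒≢ i<j refl = ℕ.<-irrefl refl i<j
  d₁ = dom x₁ (≢-sym (<⇒≢ x<x₁)) (<⇒≢ (ℕ.<-trans x₁<x₂ x₂<y))
  d₂ = dom x₂ (≢-sym (<⇒≢ (ℕ.<-trans x<x₁ x₁<x₂))) (<⇒≢ x₂<y)
  d₃ = dom (fromℕ n) (≢-sym (<⇒≢ (ℕ.<-trans (ℕ.<-trans x<x₁ (ℕ.<-trans x₁<x₂ x₂<y)) y<last)))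
                     (≢-sym (<⇒≢ y<last))

-- The values at `p` may differ: every comparison involving `p` is settled by maximality, and all
-- others agree.
contained-maximum : ∀ {u v : Fin (suc n) → ℕ} p → (∀ i → u (punchIn p i) ≡ v (punchIn p i)) →
  (∀ i → u (punchIn p i) ℕ.< u p) → (∀ i → v (punchIn p i) ℕ.< v p) → ContainedIn u → ContainedIn v
contained-maximum {u = u} {v} p u≗v u-max v-max = contained-reorder f
  where
  f : ∀ i j → u i ℕ.< u j → v i ℕ.< v j
  f i j lt with p ≟ i | p ≟ j
  ... | yes refl | yes refl = contradiction lt (ℕ.<-irrefl refl)
  ... | yes refl | no p≢j with j′ , refl ← punched p≢j = contradiction lt (ℕ.<-asym (u-max j′))
  f i j lt | no p≢i | yes refl with i′ , refl ← punched p≢i = v-max i′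
  f i j lt | no p≢i | no p≢j with i′ , refl ← punched p≢i | j′ , refl ← punched p≢j =
    subst₂ ℕ._<_ (u≗v i′) (u≗v j′) lt

-- Inserting a new maximum

ins : Vec (Fin n) n → Fin (suc n) → Vec (Fin (suc n)) (suc n)
ins {n} σ k = insertAt (Vec.map inject₁ σ) k (fromℕ n)

lookup-ins-slot : ∀ (σ : Vec (Fin n) n) k → lookup (ins σ k) k ≡ fromℕ n
lookup-ins-slot {n} σ k = Vec.insertAt-lookup (Vec.map inject₁ σ) k (fromℕ n)

lookup-ins-punchIn : ∀ (σ : Vec (Fin n) n) k i → lookup (ins σ k) (punchIn k i) ≡ inject₁ (lookup σ i)
lookup-ins-punchIn σ k i = trans (Vec.insertAt-punchIn (Vec.map inject₁ σ) k _ i) (Vec.lookup-map i inject₁ σ)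

word-ins-slot : ∀ (σ : Vec (Fin n) n) k → word (ins σ k) k ≡ n
word-ins-slot {n} σ k = trans (cong toℕ (lookup-ins-slot σ k)) (toℕ-fromℕ n)

word-ins-punchIn : ∀ (σ : Vec (Fin n) n) k i → word (ins σ k) (punchIn k i) ≡ word σ i
word-ins-punchIn σ k i = trans (cong toℕ (lookup-ins-punchIn σ k i)) (toℕ-inject₁ (lookup σ i))

word-ins-< : ∀ (σ : Vec (Fin n) n) k i → word (ins σ k) (punchIn k i) ℕ.< word (ins σ k) k
word-ins-< σ k i = subst₂ ℕ._<_ (sym (word-ins-punchIn σ k i)) (sym (word-ins-slot σ k)) (toℕ<n (lookup σ i))

≗⇒contained : {u v : Fin n → ℕ} → u ≗ v → ContainedIn u → ContainedIn v
≗⇒contained u≗v = contained-reorder λ i j → subst₂ ℕ._<_ (u≗v i) (u≗v j)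

-- Deleting position `punchIn j k` renumbers position `j` to `pinch k j`.
punchIn-pinch : ∀ (j : Fin (suc (suc n))) (k : Fin (suc n)) → punchIn (punchIn j k) (pinch k j) ≡ j
punchIn-pinch zero    k       = refl
punchIn-pinch (suc j) zero    = refl
punchIn-pinch {suc n} (suc j) (suc k) = cong suc (punchIn-pinch j k)

-- Removing the two positions of the maxima in either order leaves the same embedding of the
-- remaining letters.
punchIn-punchIn-pinch : ∀ (j : Fin (suc (suc n))) (k : Fin (suc n)) i →
  punchIn (punchIn j k) (punchIn (pinch k j) i) ≡ punchIn j (punchIn k i)
punchIn-punchIn-pinch zero    k       i       = refl
punchIn-punchIn-pinch (suc j) zero    i       = refl
punchIn-punchIn-pinch {suc n} (suc j) (suc k) zero    = refl
punchIn-punchIn-pinch {suc n} (suc j) (suc k) (suc i) = cong suc (punchIn-punchIn-pinch j k i)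

-- In ins (ins σ k) j the two largest letters sit at x and j; deleting the one at x leaves, up to order
-- isomorphism, σ with a maximum inserted at slot pinch k j.
module _ (σ : Vec (Fin n) n) (k : Fin (suc n)) (j : Fin (suc (suc n))) where
  private
    x : Fin (suc (suc n))
    x = punchIn j k

    w : Fin (suc (suc n)) → ℕ
    w = word (ins (ins σ k) j)

    w-base : ∀ i → w (punchIn j (punchIn k i)) ≡ word σ i
    w-base i = trans (word-ins-punchIn (ins σ k) j (punchIn k i)) (word-ins-punchIn σ k i)

    w-x : w x ≡ n
    w-x = trans (word-ins-punchIn (ins σ k) j k) (word-ins-slot σ k)

    w-j : w j ≡ suc n
    w-j = word-ins-slot (ins σ k) j

    dom : DominatedBy w x j
    dom i i≢x i≢j with i′ , refl ← punched (≢-sym i≢j)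
      with i″ , refl ← punched {p = k} {i = i′} (λ { refl → i≢x refl })
      = subst₂ ℕ._<_ (sym (w-base i″)) (sym w-x) (toℕ<n (lookup σ i″))
      , subst₂ ℕ._<_ (sym (w-base i″)) (sym w-j) (ℕ.m<n⇒m<1+n (toℕ<n (lookup σ i″)))

    u : Fin (suc n) → ℕ
    u = w ∘ punchIn x

    v : Fin (suc n) → ℕ
    v = word (ins σ (pinch k j))

    u≗v : ∀ i → u (punchIn (pinch k j) i) ≡ v (punchIn (pinch k j) i)
    u≗v i = trans (cong w (punchIn-punchIn-pinch j k i))
                  (trans (w-base i) (sym (word-ins-punchIn σ (pinch k j) i)))

    u-max : ∀ i → u (punchIn (pinch k j) i) ℕ.< u (pinch k j)
    u-max i = subst₂ ℕ._<_ (sym (trans (cong w (punchIn-punchIn-pinch j k i)) (w-base i)))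
                           (sym (trans (cong w (punchIn-pinch j k)) w-j))
                           (ℕ.m<n⇒m<1+n (toℕ<n (lookup σ i)))

  contains-ins-ins : Contains (ins (ins σ k) j) ⇔
    (Contains (ins σ (pinch k j)) ⊎ Contains (ins σ k) ⊎ (Far x j ⊎ Far j x))
  contains-ins-ins = mk⇔ to from
    where
    to : ContainedIn w → _
    to c with contained-dominated⁻ {w = w} (punchInᵢ≢i j k) dom c
    ... | inj₁ c′        = inj₁ (contained-maximum (pinch k j) u≗v u-max (word-ins-< σ (pinch k j)) c′)
    ... | inj₂ (inj₁ c′) = inj₂ (inj₁ (≗⇒contained (word-ins-punchIn (ins σ k) j) c′))
    ... | inj₂ (inj₂ f)  = inj₂ (inj₂ f)
    from : _ → ContainedIn w
    from (inj₁ c) = contained-punchIn {w = w} x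
      (contained-maximum (pinch k j) (sym ∘ u≗v) (word-ins-< σ (pinch k j)) u-max c)
    from (inj₂ (inj₁ c)) = contained-punchIn {w = w} j
      (≗⇒contained (sym ∘ word-ins-punchIn (ins σ k) j) c)
    from (inj₂ (inj₂ (inj₁ f))) = far⇒contained {w = w} dom f
    from (inj₂ (inj₂ (inj₂ f))) = far⇒contained {w = w} (dominated-sym {w = w} dom) f

-- Evolution of the word of active slots

isLast : Fin (suc n) → Bool
isLast {zero}  zero    = true
isLast {suc n} zero    = false
isLast {suc n} (suc i) = isLast i

-- Here `k` is the position of the older maximum before the insertion at `j`. An insertion to its
-- left shifts it by one, so the bounds on the two sides differ by one. The recursion runs parallel
-- to that of `child`.
near : Fin (suc n) → Fin (suc (suc n)) → Bool
near zero          zero                = true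
near zero          (suc zero)          = true
near zero          (suc (suc zero))    = true
near {suc (suc n)} zero (suc (suc (suc j))) = isLast j
near {suc n}       (suc k) (suc j)     = near k j
near (suc zero)    zero                = true
near {suc (suc n)} (suc (suc k)) zero  = isLast k

isLast⇔ : ∀ (i : Fin (suc n)) → T (isLast i) ⇔ (¬ toℕ i ℕ.< n)
isLast⇔ {zero}  zero    = mk⇔ (λ _ ()) (λ _ → tt)
isLast⇔ {suc n} zero    = mk⇔ (λ ()) (λ nz → contradiction (s≤s z≤n) nz)
isLast⇔ {suc n} (suc i) = mk⇔ (λ l → to l ∘ s<s⁻¹) (λ nl → from (nl ∘ s<s))
  where open Equivalence (isLast⇔ i)

far-suc⁻ : ∀ {x y : Fin (suc n)} → Far (suc x) (suc y) → Far x y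
far-suc⁻ (s≤s p , s≤s q) = p , q

far-suc⁺ : ∀ {x y : Fin (suc n)} → Far x y → Far (suc x) (suc y)
far-suc⁺ (p , q) = s≤s p , s≤s q

near⇔ : ∀ (k : Fin (suc n)) j → T (near k j) ⇔ (¬ (Far (punchIn j k) j ⊎ Far j (punchIn j k)))
near⇔ zero zero = mk⇔ (λ { _ (inj₂ (s≤s () , _)) }) (λ _ → tt)
near⇔ zero (suc zero) = mk⇔ (λ { _ (inj₁ (s≤s () , _)) }) (λ _ → tt)
near⇔ zero (suc (suc zero)) = mk⇔ (λ { _ (inj₁ (s≤s (s≤s ()) , _)) }) (λ _ → tt)
near⇔ {suc (suc n)} zero (suc (suc (suc j))) =
  mk⇔ (λ { l (inj₁ (_ , s≤s (s≤s (s≤s j<n)))) → Equivalence.to (isLast⇔ j) l j<n })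
      (λ nf → Equivalence.from (isLast⇔ j) λ j<n → nf (inj₁ (s≤s (s≤s (s≤s z≤n)) , s≤s (s≤s (s≤s j<n)))))
near⇔ (suc zero) zero = mk⇔ (λ { _ (inj₂ (s≤s (s≤s ()) , _)) }) (λ _ → tt)
near⇔ {suc (suc n)} (suc (suc k)) zero =
  mk⇔ (λ { l (inj₂ (_ , s≤s (s≤s (s≤s k<n)))) → Equivalence.to (isLast⇔ k) l k<n })
      (λ nf → Equivalence.from (isLast⇔ k) λ k<n → nf (inj₂ (s≤s (s≤s (s≤s z≤n)) , s≤s (s≤s (s≤s k<n)))))
near⇔ {suc n} (suc k) (suc j) =
  mk⇔ (λ l → [ (λ f → to l (inj₁ (far-suc⁻ f))) , (λ f → to l (inj₂ (far-suc⁻ f))) ]′)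
      (λ nf → from λ { (inj₁ f) → nf (inj₁ (far-suc⁺ f)) ; (inj₂ f) → nf (inj₂ (far-suc⁺ f)) })
  where open Equivalence (near⇔ k j)

AvoidsIns : Vec (Fin n) n × Fin (suc n) → Set
AvoidsIns (σ , k) = Avoids (ins σ k)

-- Abstract, so that conversion checking never unfolds the exhaustive search.
abstract
  avoids-ins? : (x : Vec (Fin n) n × Fin (suc n)) → Dec (AvoidsIns x)
  avoids-ins? (σ , k) = avoids? (ins σ k)

active : Vec (Fin n) n → Fin (suc n) → Bool
active σ k = does (avoids-ins? (σ , k))

-- Of the three alternatives in `contains-ins-ins`, the second is excluded because slot `k` is
-- active; the first concerns the slot `pinch k j` from which `j` descends, and the third is the
-- failure of `near`.
active-ins : ∀ (σ : Vec (Fin n) n) k j → Avoids (ins σ k) →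
             active (ins σ k) j ≡ active σ (pinch k j) ∧ near k j
active-ins σ k j av = does-⇔ (mk⇔ to′ from′)
    (avoids-ins? (ins σ k , j)) (avoids-ins? (σ , pinch k j) ×-dec T? (near k j))
  where
  open Equivalence (contains-ins-ins σ k j)
  to′ : Avoids (ins (ins σ k) j) → Avoids (ins σ (pinch k j)) × T (near k j)
  to′ av′ = av′ ∘ from ∘ inj₁ , Equivalence.from (near⇔ k j) (av′ ∘ from ∘ inj₂ ∘ inj₂)
  from′ : Avoids (ins σ (pinch k j)) × T (near k j) → Avoids (ins (ins σ k) j)
  from′ (av′ , l) c with to c
  ... | inj₁ c′        = av′ c′
  ... | inj₂ (inj₁ c′) = av c′
  ... | inj₂ (inj₂ f)  = Equivalence.to (near⇔ k j) l f

bits : Vec (Fin n) n → List Bool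
bits σ = tabulate (active σ)

keepLast : List Bool → List Bool
keepLast []           = []
keepLast (x ∷ [])     = x ∷ []
keepLast (x ∷ y ∷ ys) = false ∷ keepLast (y ∷ ys)

lastAt : ℕ → List Bool → Bool
lastAt _       []          = false
lastAt zero    (x ∷ [])    = true
lastAt zero    (x ∷ _ ∷ _) = false
lastAt (suc k) (x ∷ xs)    = lastAt k xs

-- An insertion k places after the head of xs keeps the slot just before xs only at distance two or as last letter.
survives : ℕ → List Bool → Bool
survives zero    xs = true
survives (suc k) xs = lastAt (suc k) xs

-- The slots right of the two copies: the first of them puts the maxima at distance two, and a later
-- one survives only if it is last.
after : List Bool → List Bool
after []       = []
after (y ∷ ys) = y ∷ keepLast ys

-- Inserting at slot k splits it into two adjacent slots; only meaningful when slot k is active.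
child : ℕ → List Bool → List Bool
child k       []       = []
child zero    (x ∷ ys) = x ∷ x ∷ after ys
child (suc k) (x ∷ xs) = (x ∧ survives k xs) ∷ child k xs

tabulate-isLast : ∀ (f : Fin (suc n) → Bool) →
  tabulate (λ j → f j ∧ isLast j) ≡ keepLast (tabulate f)
tabulate-isLast {zero}  f = cong (_∷ []) (∧-identityʳ _)
tabulate-isLast {suc n} f = cong₂ _∷_ (∧-zeroʳ _) (tabulate-isLast (f ∘ suc))

lastAt-tabulate : ∀ (f : Fin (suc n) → Bool) (k : Fin (suc n)) → lastAt (toℕ k) (tabulate f) ≡ isLast k
lastAt-tabulate {zero}  f zero    = refl
lastAt-tabulate {suc n} f zero    = refl
lastAt-tabulate {suc n} f (suc k) = lastAt-tabulate (f ∘ suc) k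

tabulate-child : ∀ (f : Fin (suc n) → Bool) k →
  tabulate (λ j → f (pinch k j) ∧ near k j) ≡ child (toℕ k) (tabulate f)
tabulate-child {zero} f zero = cong₂ (λ x y → x ∷ y ∷ []) (∧-identityʳ _) (∧-identityʳ _)
tabulate-child {suc zero} f zero
  rewrite ∧-identityʳ (f zero) | ∧-identityʳ (f (suc zero)) = refl
tabulate-child {suc (suc n)} f zero
  rewrite ∧-identityʳ (f zero) | ∧-identityʳ (f (suc zero)) =
  cong (λ t → f zero ∷ f zero ∷ f (suc zero) ∷ t) (tabulate-isLast (λ i → f (suc (suc i))))
tabulate-child {suc n} f (suc k) = cong₂ _∷_ (cong (f zero ∧_) (head (f ∘ suc) k)) (tabulate-child (f ∘ suc) k)
  where
  head : ∀ {n} (f : Fin (suc n) → Bool) (k : Fin (suc n)) → near (suc k) zero ≡ survives (toℕ k) (tabulate f)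
  head f zero = refl
  head {suc n} f (suc k) = sym (lastAt-tabulate (f ∘ suc) k)

bits-ins : ∀ (σ : Vec (Fin n) n) k → Avoids (ins σ k) → bits (ins σ k) ≡ child (toℕ k) (bits σ)
bits-ins σ k av = trans (tabulate-cong (λ j → active-ins σ k j av)) (tabulate-child (active σ) k)

-- Enumeration by insertion of maxima

slots : ∀ n → List (Vec (Fin n) n × Fin (suc n))

avoiders : ∀ n → List (Vec (Fin n) n)
avoiders zero    = [ Vec.[] ]
avoiders (suc n) = map (uncurry ins) (filter avoids-ins? (slots n))

slots n = cartesianProduct (avoiders n) (allFin (suc n))

lookup-extensional : {u v : Vec A n} → lookup u ≗ lookup v → u ≡ v
lookup-extensional {u = u} {v} eq =
  trans (sym (Vec.tabulate∘lookup u)) (trans (Vec.tabulate-cong eq) (Vec.tabulate∘lookup v))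

ins-injective : ∀ {x y : Vec (Fin n) n × Fin (suc n)} → uncurry ins x ≡ uncurry ins y → x ≡ y
ins-injective {n} {σ , k} {τ , l} eq with k ≟ l
... | no k≢l with i , p ← punched (≢-sym k≢l) =
      contradiction (trans (sym (lookup-ins-slot σ k))
                    (trans (cong₂ lookup eq (sym p)) (lookup-ins-punchIn τ l i))) fromℕ≢inject₁
... | yes refl = cong (_, k) (lookup-extensional λ i → inject₁-injective
      (trans (sym (lookup-ins-punchIn σ k i))
             (trans (cong (λ v → lookup v (punchIn k i)) eq) (lookup-ins-punchIn τ k i))))

avoiders-unique : ∀ n → Unique (avoiders n)
avoiders-unique zero    = [] ∷ []
avoiders-unique (suc n) = Unique.map⁺ ins-injective
  (Unique.filter⁺ avoids-ins? (Unique.cartesianProduct⁺ (avoiders-unique n) (Unique.allFin⁺ (suc n))))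

isPerm-ins : ∀ {σ : Vec (Fin n) n} k → IsPerm σ → IsPerm (ins σ k)
isPerm-ins {n} {σ} k perm i j eq with k ≟ i | k ≟ j
... | yes refl | yes refl = refl
... | yes refl | no k≢j with j′ , refl ← punched k≢j =
  contradiction (trans (sym (lookup-ins-slot σ k)) (trans eq (lookup-ins-punchIn σ k j′))) fromℕ≢inject₁
isPerm-ins {n} {σ} k perm i j eq | no k≢i | yes refl with i′ , refl ← punched k≢i =
  contradiction (trans (sym (lookup-ins-slot σ k)) (trans (sym eq) (lookup-ins-punchIn σ k i′))) fromℕ≢inject₁
isPerm-ins {n} {σ} k perm i j eq | no k≢i | no k≢j with i′ , refl ← punched k≢i | j′ , refl ← punched k≢j =
  cong (punchIn k) (perm i′ j′ (inject₁-injective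
    (trans (sym (lookup-ins-punchIn σ k i′)) (trans eq (lookup-ins-punchIn σ k j′)))))

-- If the value `n` were missed, all `suc n` letters would fit into `Fin n`, and the pigeonhole
-- principle would give a repetition.
isPerm⇒attains-max : (π : Vec (Fin (suc n)) (suc n)) → IsPerm π → ∃[ k ] lookup π k ≡ fromℕ n
isPerm⇒attains-max {n} π perm with any? (λ k → lookup π k ≟ fromℕ n)
... | yes k = k
... | no none = contradiction (perm i j (eq i≡j)) (λ e → ℕ.<-irrefl (cong toℕ e) i<j)
  where
  not-max : ∀ k → n ≢ toℕ (lookup π k)
  not-max k e = none (k , toℕ-injective (trans (sym e) (sym (toℕ-fromℕ n))))
  collision = pigeonhole (ℕ.n<1+n n) (λ k → lower₁ (lookup π k) (not-max k))
  i = proj₁ collision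
  j = proj₁ (proj₂ collision)
  i<j = proj₁ (proj₂ (proj₂ collision))
  i≡j = proj₂ (proj₂ (proj₂ collision))
  eq : lower₁ (lookup π i) (not-max i) ≡ lower₁ (lookup π j) (not-max j) → lookup π i ≡ lookup π j
  eq = lower₁-injective

uninsert : (π : Vec (Fin (suc n)) (suc n)) → IsPerm π → ∃[ σ ] ∃[ k ] IsPerm σ × ins σ k ≡ π
uninsert {n} π perm with k , max ← isPerm⇒attains-max π perm = σ , k , perm-σ , lookup-extensional eq
  where
  not-max : ∀ i → n ≢ toℕ (lookup π (punchIn k i))
  not-max i e = punchInᵢ≢i k i
    (perm _ _ (trans (toℕ-injective (trans (sym e) (sym (toℕ-fromℕ n)))) (sym max)))
  σ : Vec (Fin n) n
  σ = Vec.tabulate λ i → lower₁ (lookup π (punchIn k i)) (not-max i)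
  lookup-σ : ∀ i → inject₁ (lookup σ i) ≡ lookup π (punchIn k i)
  lookup-σ i = trans (cong inject₁ (Vec.lookup∘tabulate _ i)) (inject₁-lower₁ _ (not-max i))
  perm-σ : IsPerm σ
  perm-σ i j e = punchIn-injective k i j
    (perm _ _ (trans (sym (lookup-σ i)) (trans (cong inject₁ e) (lookup-σ j))))
  eq : lookup (ins σ k) ≗ lookup π
  eq i with k ≟ i
  ... | yes refl = trans (lookup-ins-slot σ k) (sym max)
  ... | no k≢i with i′ , refl ← punched k≢i = trans (lookup-ins-punchIn σ k i′) (lookup-σ i′)

contains-ins : ∀ (σ : Vec (Fin n) n) k → Contains σ → Contains (ins σ k)
contains-ins σ k c = contained-punchIn k (≗⇒contained (sym ∘ word-ins-punchIn σ k) c)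

∈-slots⁺ : ∀ {σ : Vec (Fin n) n} k → σ ∈ avoiders n → (σ , k) ∈ slots n
∈-slots⁺ k σ∈ = ∈-cartesianProduct⁺ σ∈ (∈-allFin k)

∈-slots⁻ : ∀ {x : Vec (Fin n) n × Fin (suc n)} → x ∈ slots n → proj₁ x ∈ avoiders n
∈-slots⁻ {n} x∈ = proj₁ (∈-cartesianProduct⁻ (avoiders n) (allFin (suc n)) x∈)

-- Deleting the maximum of an avoider leaves an avoider, so inserting into avoiders alone reaches
-- every avoider.
∈-avoiders⁺ : ∀ n {π : Vec (Fin n) n} → IsPerm π → Avoids π → π ∈ avoiders n
∈-avoiders⁺ zero {Vec.[]} perm av = here refl
∈-avoiders⁺ (suc n) {π} perm = inserted (uninsert π perm)
  where
  inserted : (∃[ σ ] ∃[ k ] IsPerm σ × ins σ k ≡ π) → Avoids π → π ∈ avoiders (suc n)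
  inserted (σ , k , perm-σ , refl) av =
    ∈-map⁺ (uncurry ins) (∈-filter⁺ {P = AvoidsIns} avoids-ins?
      (∈-slots⁺ k (∈-avoiders⁺ n perm-σ (av ∘ contains-ins σ k))) av)

∈-avoiders⁻ : ∀ n {π : Vec (Fin n) n} → π ∈ avoiders n → IsPerm π × Avoids π
∈-avoiders⁻ zero    {Vec.[]} _  = (λ ()) , λ { (() , _) }
∈-avoiders⁻ (suc n) {π} π∈ = inserted (∈-map⁻ (uncurry ins) {xs = filter avoids-ins? (slots n)} π∈)
  where
  inserted : (∃[ x ] x ∈ filter avoids-ins? (slots n) × π ≡ uncurry ins x) → IsPerm π × Avoids π
  inserted ((σ , k) , x∈ , refl) =
    let x∈slots , av = ∈-filter⁻ {P = AvoidsIns} avoids-ins? {xs = slots n} x∈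
    in isPerm-ins {σ = σ} k (proj₁ (∈-avoiders⁻ n (∈-slots⁻ x∈slots))) , av

-- As a mapped Cartesian product, the list inherits uniqueness and membership from products.
allVecs≡ : ∀ m n → allVecs (suc m) n ≡ map (uncurry Vec._∷_) (cartesianProduct (allFin n) (allVecs m n))
allVecs≡ m n = go (allFin n)
  where
  go : ∀ xs → concatMap (λ x → map (x Vec.∷_) (allVecs m n)) xs ≡
              map (uncurry Vec._∷_) (cartesianProduct xs (allVecs m n))
  go []       = refl
  go (x ∷ xs) = trans (cong₂ _++_ (map-∘ (allVecs m n)) (go xs))
                      (sym (map-++ (uncurry Vec._∷_) (map (x ,_) (allVecs m n)) _))

allVecs-unique : ∀ m n → Unique (allVecs m n)
allVecs-unique zero    n = [] ∷ []
allVecs-unique (suc m) n rewrite allVecs≡ m n =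
  Unique.map⁺ (λ { refl → refl }) (Unique.cartesianProduct⁺ (Unique.allFin⁺ n) (allVecs-unique m n))

∈-allVecs : (v : Vec (Fin n) m) → v ∈ allVecs m n
∈-allVecs {m = zero}  Vec.[] = here refl
∈-allVecs {n} {suc m} (x Vec.∷ v) rewrite allVecs≡ m n =
  ∈-map⁺ (uncurry Vec._∷_) (∈-cartesianProduct⁺ (∈-allFin x) (∈-allVecs v))

-- Both lists are free of duplicates and have the same members, so each is a rearrangement of the
-- other.
a≡length-avoiders : ∀ n → a n ≡ length (avoiders n)
a≡length-avoiders n = ↭-length (∼bag⇒↭ (unique∧set⇒bag (Unique.filter⁺ _ (allVecs-unique n n)) (avoiders-unique n)
  (mk⇔ (λ ∈f → uncurry (∈-avoiders⁺ n) (proj₂ (∈-filter⁻ good? {xs = allVecs n n} ∈f)))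
       (λ ∈a → ∈-filter⁺ good? (∈-allVecs _) (∈-avoiders⁻ n ∈a)))))
  where
  good? : (π : Vec (Fin n) n) → Dec (IsPerm π × Avoids π)
  good? π = isPerm? π ×-dec avoids? π

bits-[] : bits Vec.[] ≡ true ∷ []
bits-[] with avoids-ins? (Vec.[] , zero)
... | yes _ = refl
... | no c  = contradiction (λ { (zero , zero , _ , _ , _ , (() , _) , _) }) c

-- Counting descendants

weight : (ℕ → ℕ) → List Bool → ℕ
weight φ []       = 0
weight φ (x ∷ xs) = (if x then φ 0 else 0) + weight (φ ∘ suc) xs

-- The number of nodes `n` levels below a node with state `v` in the generating tree; only active
-- slots have children.
descendants : ℕ → List Bool → ℕ
descendants zero    v = 1
descendants (suc n) v = weight (λ k → descendants n (child k v)) v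

sum-map-filter : ∀ {P : A → Set} (P? : ∀ x → Dec (P x)) (φ : A → ℕ) xs →
  sum (map φ (filter P? xs)) ≡ sum (map (λ x → if does (P? x) then φ x else 0) xs)
sum-map-filter P? φ [] = refl
sum-map-filter P? φ (x ∷ xs) with does (P? x)
... | true  = cong (_+_ (φ x)) (sum-map-filter P? φ xs)
... | false = sum-map-filter P? φ xs

sum-map-cartesianProduct : ∀ (φ : A × B → ℕ) xs ys →
  sum (map φ (cartesianProduct xs ys)) ≡ sum (map (λ x → sum (map (λ y → φ (x , y)) ys)) xs)
sum-map-cartesianProduct φ []       ys = refl
sum-map-cartesianProduct φ (x ∷ xs) ys = begin
  sum (map φ (map (x ,_) ys ++ cartesianProduct xs ys))
    ≡⟨ cong sum (map-++ φ (map (x ,_) ys) _) ⟩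
  sum (map φ (map (x ,_) ys) ++ map φ (cartesianProduct xs ys))
    ≡⟨ sum-++ (map φ (map (x ,_) ys)) _ ⟩
  sum (map φ (map (x ,_) ys)) + sum (map φ (cartesianProduct xs ys))
    ≡⟨ cong₂ _+_ (cong sum (sym (map-∘ ys))) (sum-map-cartesianProduct φ xs ys) ⟩
  sum (map (λ y → φ (x , y)) ys) + sum (map (λ x → sum (map (λ y → φ (x , y)) ys)) xs) ∎
  where open ≡-Reasoning

sum-tabulate-if : ∀ (f : Fin n → Bool) (φ : ℕ → ℕ) →
  sum (tabulate (λ k → if f k then φ (toℕ k) else 0)) ≡ weight φ (tabulate f)
sum-tabulate-if {zero}  f φ = refl
sum-tabulate-if {suc n} f φ = cong (_+_ _) (sum-tabulate-if (f ∘ suc) (φ ∘ suc))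

if-dec-cong : ∀ {P : Set} (P? : Dec P) {x y : ℕ} → (P → x ≡ y) →
              (if does P? then x else 0) ≡ (if does P? then y else 0)
if-dec-cong (yes p) eq = eq p
if-dec-cong (no _)  eq = refl

sum-children : ∀ n (σ : Vec (Fin m) m) →
  sum (map (λ k → if active σ k then descendants n (bits (ins σ k)) else 0) (allFin (suc m)))
    ≡ descendants (suc n) (bits σ)
sum-children {m} n σ = begin
  sum (map ψ (allFin (suc m)))  ≡⟨ cong sum (map-tabulate id ψ) ⟩
  sum (tabulate ψ)              ≡⟨ cong sum (tabulate-cong λ k → if-dec-cong (avoids-ins? (σ , k)) λ av →
                                     cong (descendants n) (bits-ins σ k av)) ⟩
  sum (tabulate λ k → if active σ k then descendants n (child (toℕ k) (bits σ)) else 0)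
                                ≡⟨ sum-tabulate-if (active σ) (λ k → descendants n (child k (bits σ))) ⟩
  descendants (suc n) (bits σ)  ∎
  where
  open ≡-Reasoning
  ψ : Fin (suc m) → ℕ
  ψ k = if active σ k then descendants n (bits (ins σ k)) else 0

-- Each step of the induction trades one level of descent for one actual insertion, raising `m` by
-- one.
sum-descendants : ∀ n m → sum (map (descendants n ∘ bits) (avoiders m)) ≡ length (avoiders (n + m))
sum-descendants zero    m = sum-ones (avoiders m)
  where
  sum-ones : ∀ (xs : List A) → sum (map (λ _ → 1) xs) ≡ length xs
  sum-ones []       = refl
  sum-ones (x ∷ xs) = cong suc (sum-ones xs)
sum-descendants (suc n) m = begin
  sum (map (descendants (suc n) ∘ bits) (avoiders m))
    ≡⟨ cong sum (map-cong (sum-children n) (avoiders m)) ⟨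
  sum (map (λ σ → sum (map (λ k → if active σ k then descendants n (bits (ins σ k)) else 0) (allFin (suc m))))
           (avoiders m))
    ≡⟨ sum-map-cartesianProduct _ (avoiders m) (allFin (suc m)) ⟨
  sum (map (λ x → if does (avoids-ins? x) then descendants n (bits (uncurry ins x)) else 0) (slots m))
    ≡⟨ sum-map-filter avoids-ins? (descendants n ∘ bits ∘ uncurry ins) (slots m) ⟨
  sum (map (descendants n ∘ bits ∘ uncurry ins) (filter avoids-ins? (slots m)))
    ≡⟨ cong sum (map-∘ (filter avoids-ins? (slots m))) ⟩
  sum (map (descendants n ∘ bits) (avoiders (suc m)))
    ≡⟨ sum-descendants n (suc m) ⟩
  length (avoiders (n + suc m))
    ≡⟨ cong (length ∘ avoiders) (ℕ.+-suc n m) ⟩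
  length (avoiders (suc n + m)) ∎
  where
  open ≡-Reasoning

root : ℕ → ℕ
root n = descendants n (true ∷ [])

a≡root : ∀ n → a n ≡ root n
a≡root n = begin
  a n                        ≡⟨ a≡length-avoiders n ⟩
  length (avoiders n)        ≡⟨ cong (length ∘ avoiders) (ℕ.+-identityʳ n) ⟨
  length (avoiders (n + 0))  ≡⟨ sum-descendants n 0 ⟨
  descendants n (bits Vec.[]) + 0
                             ≡⟨ cong (λ v → descendants n v + 0) bits-[] ⟩
  root n + 0                 ≡⟨ ℕ.+-identityʳ (root n) ⟩
  root n                     ∎
  where open ≡-Reasoning

-- Descendants of runs and clusters of active slots

zeros ones : ℕ → List Bool
zeros n = replicate n false
ones  n = replicate n true

weight-cong : ∀ {φ ψ : ℕ → ℕ} → φ ≗ ψ → weight φ ≗ weight ψ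
weight-cong eq []           = refl
weight-cong eq (true ∷ xs)  = cong₂ _+_ (eq 0) (weight-cong (eq ∘ suc) xs)
weight-cong eq (false ∷ xs) = weight-cong (eq ∘ suc) xs

weight-++ : ∀ φ xs ys → weight φ (xs ++ ys) ≡ weight φ xs + weight (λ k → φ (length xs + k)) ys
weight-++ φ []       ys = refl
weight-++ φ (x ∷ xs) ys = trans (cong (_+_ (if x then φ 0 else 0)) (weight-++ (φ ∘ suc) xs ys))
                                (sym (ℕ.+-assoc (if x then φ 0 else 0) _ _))

weight-zeros : ∀ φ g → weight φ (zeros g) ≡ 0
weight-zeros φ zero    = refl
weight-zeros φ (suc g) = weight-zeros (φ ∘ suc) g

weight-ones-suc : ∀ φ t → weight φ (ones (suc t)) ≡ weight φ (ones t) + φ t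
weight-ones-suc φ zero    = ℕ.+-identityʳ (φ 0)
weight-ones-suc φ (suc t) = trans (cong (_+_ (φ 0)) (weight-ones-suc (φ ∘ suc) t)) (sym (ℕ.+-assoc (φ 0) _ _))

weight-ones-cong : ∀ {φ ψ : ℕ → ℕ} t → (∀ k → k ℕ.< t → φ k ≡ ψ k) → weight φ (ones t) ≡ weight ψ (ones t)
weight-ones-cong zero    eq = refl
weight-ones-cong (suc t) eq = cong₂ _+_ (eq 0 (s≤s z≤n)) (weight-ones-cong t λ k k<t → eq (suc k) (s≤s k<t))

-- A leading inactive slot offers no insertion and stays inactive, and the fate of a slot under
-- insertions to its right or at itself never depends on what precedes it.
descendants-false : ∀ n v → descendants n (false ∷ v) ≡ descendants n v
descendants-false zero    v = refl
descendants-false (suc n) v = weight-cong (λ k → descendants-false n (child k v)) v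

keepLast-ones : ∀ t → keepLast (ones (suc t)) ≡ zeros t ++ ones 1
keepLast-ones zero    = refl
keepLast-ones (suc t) = cong (false ∷_) (keepLast-ones t)

keepLast-zeros-ones : ∀ g t → keepLast (zeros g ++ ones (suc t)) ≡ zeros (g + t) ++ ones 1
keepLast-zeros-ones zero          t = keepLast-ones t
keepLast-zeros-ones (suc zero)    t = cong (false ∷_) (keepLast-ones t)
keepLast-zeros-ones (suc (suc g)) t = cong (false ∷_) (keepLast-zeros-ones (suc g) t)

lastAt-++ : ∀ xs k ys → lastAt (length xs + k) (xs ++ ys) ≡ lastAt k ys
lastAt-++ []       k ys = refl
lastAt-++ (x ∷ xs) k ys = lastAt-++ xs k ys

lastAt-ones : ∀ t → lastAt t (ones (suc t)) ≡ true
lastAt-ones zero    = refl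
lastAt-ones (suc t) = lastAt-ones t

¬lastAt-ones : ∀ {k t} → k ℕ.< t → lastAt k (ones (suc t)) ≡ false
¬lastAt-ones {zero}  {suc t} _     = refl
¬lastAt-ones {suc k} {suc t} k<t = ¬lastAt-ones (s<s⁻¹ k<t)

survives-last : ∀ k xs → lastAt k xs ≡ true → survives k xs ≡ true
survives-last zero    xs eq = refl
survives-last (suc k) xs eq = eq

survives-not-last : ∀ k xs → 0 ℕ.< k → lastAt k xs ≡ false → survives k xs ≡ false
survives-not-last (suc k) xs _ eq = eq

-- The inserted maximum becomes the last letter, so every slot to its left keeps its status.
child-last-++ : ∀ xs k ys → lastAt k ys ≡ true → child (length xs + k) (xs ++ ys) ≡ xs ++ child k ys
child-last-++ []       k ys eq = refl
child-last-++ (x ∷ xs) k ys eq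
  rewrite survives-last (length xs + k) (xs ++ ys) (trans (lastAt-++ xs k ys) eq) | ∧-identityʳ x =
  cong (x ∷_) (child-last-++ xs k ys eq)

child-ones-last : ∀ t → child t (ones (suc t)) ≡ ones (suc (suc t))
child-ones-last zero    = refl
child-ones-last (suc t) rewrite survives-last t (ones (suc t)) (lastAt-ones t) = cong (true ∷_) (child-ones-last t)

child-zeros-++ : ∀ g k ys → child (length (zeros g) + k) (zeros g ++ ys) ≡ zeros g ++ child k ys
child-zeros-++ zero    k ys = refl
child-zeros-++ (suc g) k ys = cong (false ∷_) (child-zeros-++ g k ys)

descendants-zeros-++ : ∀ n g v → descendants n (zeros g ++ v) ≡ descendants n v
descendants-zeros-++ n zero    v = refl
descendants-zeros-++ n (suc g) v = trans (descendants-false n _) (descendants-zeros-++ n g v)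

descendants-child-prefix : ∀ n xs k ys → lastAt k ys ≡ false →
  descendants n (child (length xs + suc k) (xs ++ false ∷ ys)) ≡ descendants n (child k ys)
descendants-child-prefix n []       k ys eq = descendants-false n (child k ys)
descendants-child-prefix n (x ∷ xs) k ys eq
  rewrite survives-not-last (length xs + suc k) (xs ++ false ∷ ys)
            (subst (0 ℕ.<_) (sym (ℕ.+-suc (length xs) k)) (s≤s z≤n))
               (trans (lastAt-++ xs (suc k) (false ∷ ys)) eq)
        | ∧-zeroʳ x =
  trans (descendants-false n _) (descendants-child-prefix n xs k ys eq)

-- A cluster of r active slots, 1 + g inactive ones, and a final run of 1 + t; the length of the separating block
-- never matters.
clustered : ℕ → ℕ → ℕ → List Bool
clustered r g t = ones r ++ false ∷ zeros g ++ ones (suc t)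

-- Insertions into the final run other than at its last slot: these forget any cluster to the left.
innerSum : ℕ → ℕ → ℕ
innerSum n t = weight (λ k → descendants n (child k (ones (suc t)))) (ones t)

descendants-ones : ∀ n t → descendants (suc n) (ones (suc t)) ≡ innerSum n t + descendants n (ones (suc (suc t)))
descendants-ones n t = trans (weight-ones-suc _ t) (cong (λ v → innerSum n t + descendants n v) (child-ones-last t))

-- The three summands are the insertions into the cluster, those into the final run before its last
-- slot, and the one at the last slot, which lengthens the run and preserves the cluster.
descendants-clustered : ∀ n r g t →
  descendants (suc n) (clustered r g t) ≡
    weight (λ k → descendants n (child k (clustered r g t))) (ones r) +
    (innerSum n t + descendants n (clustered r g (suc t)))
descendants-clustered n r g t = begin
  weight φ (ones r ++ false ∷ zeros g ++ ones (suc t))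
    ≡⟨ weight-++ φ (ones r) _ ⟩
  weight φ (ones r) + weight (λ k → φ (length (ones r) + suc k)) (zeros g ++ ones (suc t))
    ≡⟨ cong (_+_ (weight φ (ones r))) (weight-++ _ (zeros g) _) ⟩
  weight φ (ones r) + (weight (λ k → φ (length (ones r) + suc k)) (zeros g) + weight ψ (ones (suc t)))
    ≡⟨ cong (λ z → weight φ (ones r) + (z + weight ψ (ones (suc t)))) (weight-zeros _ g) ⟩
  weight φ (ones r) + weight ψ (ones (suc t))
    ≡⟨ cong (_+_ (weight φ (ones r))) (weight-ones-suc ψ t) ⟩
  weight φ (ones r) + (weight ψ (ones t) + ψ t)
    ≡⟨ cong (_+_ (weight φ (ones r))) (cong₂ _+_ (weight-ones-cong t inner) last) ⟩
  weight φ (ones r) + (innerSum n t + descendants n (clustered r g (suc t))) ∎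
  where
  open ≡-Reasoning
  φ ψ : ℕ → ℕ
  φ k = descendants n (child k (clustered r g t))
  ψ k = φ (length (ones r) + suc (length (zeros g) + k))
  inner : ∀ k → k ℕ.< t → ψ k ≡ descendants n (child k (ones (suc t)))
  inner k k<t = begin
    ψ k ≡⟨ descendants-child-prefix n (ones r) _ _ (trans (lastAt-++ (zeros g) k _) (¬lastAt-ones k<t)) ⟩
    descendants n (child (length (zeros g) + k) (zeros g ++ ones (suc t)))
        ≡⟨ cong (descendants n) (child-zeros-++ g k _) ⟩
    descendants n (zeros g ++ child k (ones (suc t)))
        ≡⟨ descendants-zeros-++ n g _ ⟩
    descendants n (child k (ones (suc t))) ∎
  last : ψ t ≡ descendants n (clustered r g (suc t))
  last = cong (descendants n) (begin
    child (length (ones r) + suc (length (zeros g) + t)) (clustered r g t)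
      ≡⟨ child-last-++ (ones r) _ _ (trans (lastAt-++ (zeros g) t _) (lastAt-ones t)) ⟩
    ones r ++ false ∷ child (length (zeros g) + t) (zeros g ++ ones (suc t))
      ≡⟨ cong (λ v → ones r ++ false ∷ v) (trans (child-zeros-++ g t _) (cong (zeros g ++_) (child-ones-last t))) ⟩
    clustered r g (suc t) ∎)

-- gain₃ is what a cluster of three contributes on top of the bare final run.  gap is the further contribution of a
-- fourth slot in the cluster; it satisfies the same recursion as, hence equals, that of one more slot in a final
-- run of length at least four.  three and four count the descendants when the final run has length one.
mutual
  gain₃ : ℕ → ℕ
  gain₃ zero    = 0
  gain₃ (suc n) = gain₃ n + (three n + (four n + three n))

  gap : ℕ → ℕ
  gap zero    = 0
  gap (suc n) = gap n + four n

  three four : ℕ → ℕ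
  three n = root n + gain₃ n
  four  n = three n + gap n

-- Both formulas are proved together by induction on `n`. An insertion into the cluster leaves a
-- cluster of three or four and a final run of length one. The remaining insertions match those into
-- the bare run, up to the gain inherited through the last slot.
descendants-clustered₃ : ∀ n g t → descendants n (clustered 3 g t) ≡ descendants n (ones (suc t)) + gain₃ n
descendants-clustered₄ : ∀ n g t → descendants n (clustered 4 g t) ≡ descendants n (ones (suc t)) + (gain₃ n + gap n)

four-clustered : ∀ n g → descendants n (clustered 4 g 0) ≡ four n
four-clustered n g = trans (descendants-clustered₄ n g 0) (sym (ℕ.+-assoc (root n) _ _))

rearrange₃ : ∀ x y p u g → (x + (y + (x + 0))) + (p + (u + g)) ≡ p + u + (g + (x + (y + x)))
rearrange₃ = solve-∀

rearrange₄ : ∀ x y p u g d → (x + (y + (y + (x + 0)))) + (p + (u + (g + d))) ≡ p + u + (g + (x + (y + x)) + (d + y))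
rearrange₄ = solve-∀

descendants-clustered₃ zero    g t = refl
descendants-clustered₃ (suc n) g t = begin
  descendants (suc n) (clustered 3 g t)
    ≡⟨ descendants-clustered n 3 g t ⟩
  φ 0 + (φ 1 + (φ 2 + 0)) + (innerSum n t + descendants n (clustered 3 g (suc t)))
    ≡⟨ cong₂ _+_ (cong₂ _+_ φ₀ (cong₂ _+_ φ₁ (cong (_+ 0) φ₂)))
                 (cong (_+_ (innerSum n t)) (descendants-clustered₃ n g (suc t))) ⟩
  three n + (four n + (three n + 0)) + (innerSum n t + (descendants n (ones (suc (suc t))) + gain₃ n))
    ≡⟨ rearrange₃ (three n) (four n) (innerSum n t) _ (gain₃ n) ⟩
  innerSum n t + descendants n (ones (suc (suc t))) + gain₃ (suc n)
    ≡⟨ cong (_+ gain₃ (suc n)) (descendants-ones n t) ⟨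
  descendants (suc n) (ones (suc t)) + gain₃ (suc n) ∎
  where
  open ≡-Reasoning
  φ : ℕ → ℕ
  φ k = descendants n (child k (clustered 3 g t))
  φ₀ : φ 0 ≡ three n
  φ₀ = trans (cong (λ v → descendants n (true ∷ true ∷ true ∷ false ∷ v)) (keepLast-zeros-ones (suc g) t))
             (descendants-clustered₃ n (suc g + t) 0)
  φ₁ : φ 1 ≡ four n
  φ₁ = trans (cong (λ v → descendants n (true ∷ true ∷ true ∷ true ∷ v)) (keepLast-zeros-ones (suc g) t))
             (four-clustered n (g + t))
  φ₂ : φ 2 ≡ three n
  φ₂ = trans (descendants-false n _)
      (trans (cong (λ v → descendants n (true ∷ true ∷ true ∷ false ∷ v)) (keepLast-zeros-ones g t))
             (descendants-clustered₃ n (g + t) 0))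

descendants-clustered₄ zero    g t = refl
descendants-clustered₄ (suc n) g t = begin
  descendants (suc n) (clustered 4 g t)
    ≡⟨ descendants-clustered n 4 g t ⟩
  φ 0 + (φ 1 + (φ 2 + (φ 3 + 0))) + (innerSum n t + descendants n (clustered 4 g (suc t)))
    ≡⟨ cong₂ _+_ (cong₂ _+_ φ₀ (cong₂ _+_ φ₁ (cong₂ _+_ φ₂ (cong (_+ 0) φ₃))))
                 (cong (_+_ (innerSum n t)) (descendants-clustered₄ n g (suc t))) ⟩
  three n + (four n + (four n + (three n + 0))) +
    (innerSum n t + (descendants n (ones (suc (suc t))) + (gain₃ n + gap n)))
    ≡⟨ rearrange₄ (three n) (four n) (innerSum n t) _ (gain₃ n) (gap n) ⟩
  innerSum n t + descendants n (ones (suc (suc t))) + (gain₃ (suc n) + gap (suc n))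
    ≡⟨ cong (_+ (gain₃ (suc n) + gap (suc n))) (descendants-ones n t) ⟨
  descendants (suc n) (ones (suc t)) + (gain₃ (suc n) + gap (suc n)) ∎
  where
  open ≡-Reasoning
  φ : ℕ → ℕ
  φ k = descendants n (child k (clustered 4 g t))
  φ₀ : φ 0 ≡ three n
  φ₀ = trans (cong (λ v → descendants n (true ∷ true ∷ true ∷ false ∷ false ∷ v)) (keepLast-zeros-ones (suc g) t))
             (descendants-clustered₃ n (suc (suc g + t)) 0)
  φ₁ : φ 1 ≡ four n
  φ₁ = trans (cong (λ v → descendants n (true ∷ true ∷ true ∷ true ∷ false ∷ v)) (keepLast-zeros-ones (suc g) t))
             (four-clustered n (suc (g + t)))
  φ₂ : φ 2 ≡ four n
  φ₂ = trans (descendants-false n _)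
      (trans (cong (λ v → descendants n (true ∷ true ∷ true ∷ true ∷ v)) (keepLast-zeros-ones (suc g) t))
             (four-clustered n (g + t)))
  φ₃ : φ 3 ≡ three n
  φ₃ = trans (descendants-zeros-++ n 2 _)
      (trans (cong (λ v → descendants n (true ∷ true ∷ true ∷ false ∷ v)) (keepLast-zeros-ones g t))
             (descendants-clustered₃ n (g + t) 0))

-- From four slots on, at least one inactive slot separates the new cluster of three from the
-- surviving last slot.
descendants-child₀-ones : ∀ n t → descendants n (child 0 (ones (4 + t))) ≡ three n
descendants-child₀-ones n t =
  trans (cong (λ v → descendants n (true ∷ true ∷ true ∷ v)) (keepLast-ones (suc t)))
        (descendants-clustered₃ n t 0)

-- The extra insertion is the one at the second slot, which creates a cluster of four; the first
-- slots correspond, and the later ones match after a shift by one.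
innerSum-suc : ∀ n t → innerSum n (4 + t) ≡ innerSum n (3 + t) + four n
innerSum-suc n t = begin
  φ 0 + (φ 1 + weight (λ k → φ (suc (suc k))) (ones (2 + t)))
    ≡⟨ cong₂ _+_ (descendants-child₀-ones n (suc t)) (cong₂ _+_ φ₁ (weight-ones-cong (2 + t) rest)) ⟩
  three n + (four n + weight (ψ ∘ suc) (ones (2 + t)))
    ≡⟨ solve₃ (three n) (four n) _ ⟩
  three n + weight (ψ ∘ suc) (ones (2 + t)) + four n
    ≡⟨ cong (λ z → z + weight (ψ ∘ suc) (ones (2 + t)) + four n) (descendants-child₀-ones n t) ⟨
  innerSum n (3 + t) + four n ∎
  where
  open ≡-Reasoning
  φ ψ : ℕ → ℕ
  φ k = descendants n (child k (ones (5 + t)))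
  ψ k = descendants n (child k (ones (4 + t)))
  solve₃ : ∀ x y w → x + (y + w) ≡ x + w + y
  solve₃ = solve-∀
  φ₁ : φ 1 ≡ four n
  φ₁ = trans (cong (λ v → descendants n (true ∷ true ∷ true ∷ true ∷ v)) (keepLast-ones (suc t)))
             (four-clustered n t)
  -- The first slot is beyond distance two and the insertion is not last, so that slot becomes
  -- inactive and drops out.
  rest : ∀ k → k ℕ.< 2 + t → φ (suc (suc k)) ≡ ψ (suc k)
  rest k k<2+t = trans (cong (λ x → descendants n (x ∷ child (suc k) (ones (4 + t)))) (¬lastAt-ones (s<s k<2+t)))
                       (descendants-false n (child (suc k) (ones (4 + t))))

descendants-ones-suc : ∀ n t → descendants n (ones (5 + t)) ≡ descendants n (ones (4 + t)) + gap n
descendants-ones-suc zero    t = refl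
descendants-ones-suc (suc n) t = begin
  descendants (suc n) (ones (5 + t))
    ≡⟨ descendants-ones n (4 + t) ⟩
  innerSum n (4 + t) + descendants n (ones (6 + t))
    ≡⟨ cong₂ _+_ (innerSum-suc n t) (descendants-ones-suc n (suc t)) ⟩
  innerSum n (3 + t) + four n + (descendants n (ones (5 + t)) + gap n)
    ≡⟨ solve₄ (innerSum n (3 + t)) (four n) _ (gap n) ⟩
  innerSum n (3 + t) + descendants n (ones (5 + t)) + gap (suc n)
    ≡⟨ cong (_+ gap (suc n)) (descendants-ones n (3 + t)) ⟨
  descendants (suc n) (ones (4 + t)) + gap (suc n) ∎
  where
  open ≡-Reasoning
  solve₄ : ∀ p y u d → p + y + (u + d) ≡ p + u + (d + y)
  solve₄ = solve-∀

-- The finite linear system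

fourOnes : ℕ → ℕ
fourOnes n = descendants n (ones 4)

-- The insertions from left to right give a cluster of three, a run of five, a run of four behind an
-- inactive slot, and a run of five.
fourOnes-suc : ∀ n → fourOnes (suc n) ≡ 3 * fourOnes n + 2 * gap n + three n
fourOnes-suc n = begin
  fourOnes (suc n)
    ≡⟨ descendants-ones n 3 ⟩
  descendants n (child 0 (ones 4)) + (descendants n (ones 5) + (descendants n (false ∷ ones 4) + 0)) +
    descendants n (ones 5)
    ≡⟨ cong₂ _+_ (cong₂ _+_ (descendants-child₀-ones n 0)
                   (cong₂ _+_ (descendants-ones-suc n 0) (cong (_+ 0) (descendants-false n (ones 4)))))
                 (descendants-ones-suc n 0) ⟩
  three n + (fourOnes n + gap n + (fourOnes n + 0)) + (fourOnes n + gap n)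
    ≡⟨ collect (three n) (fourOnes n) (gap n) ⟩
  3 * fourOnes n + 2 * gap n + three n ∎
  where
  open ≡-Reasoning
  collect : ∀ x u d → x + (u + d + (u + 0)) + (u + d) ≡ 3 * u + 2 * d + x
  collect = solve-∀

-- All six permutations of length three have four active slots.
root-suc³ : ∀ n → root (3 + n) ≡ 6 * fourOnes n
root-suc³ n = collect (fourOnes n)
  where
  collect : ∀ u → u + (u + (u + 0)) + (u + (u + (u + 0)) + 0) + 0 ≡ 6 * u
  collect = solve-∀

gain₃-suc : ∀ n → gain₃ (suc n) ≡ 4 * gain₃ n + gap n + 3 * root n
gain₃-suc n = collect (root n) (gain₃ n) (gap n)
  where
  collect : ∀ r g d → g + (r + g + (r + g + d + (r + g))) ≡ 4 * g + d + 3 * r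
  collect = solve-∀

gap-suc : ∀ n → gap (suc n) ≡ 2 * gap n + gain₃ n + root n
gap-suc n = collect (root n) (gain₃ n) (gap n)
  where
  collect : ∀ r g d → d + (r + g + d) ≡ 2 * d + g + r
  collect = solve-∀

-- The recurrence

-- With `r`, `u`, `g`, `d` standing for `a`, `fourOnes`, `gain₃`, `gap` as opaque sequences, only
-- linear algebra remains.
module LinearSystem
  (r u g d : ℕ → ℕ)
  (r-suc³ : ∀ n → r (3 + n) ≡ 6 * u n)
  (u-suc : ∀ n → u (suc n) ≡ 3 * u n + 2 * d n + (r n + g n))
  (g-suc : ∀ n → g (suc n) ≡ 4 * g n + d n + 3 * r n)
  (d-suc : ∀ n → d (suc n) ≡ 2 * d n + g n + r n)
  (r₀ : r 0 ≡ 1) (r₁ : r 1 ≡ 1) (r₂ : r 2 ≡ 2) (r₃ : r 3 ≡ 6) (g₀ : g 0 ≡ 0) (d₀ : d 0 ≡ 0)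
  (b : ℕ → ℕ) (b₃ : b 3 ≡ 2) (b₄ : b 4 ≡ 6)
  (b-rec : ∀ n → b (5 + n) + r (2 + n) ≡ 2 * b (4 + n) + b (3 + n) + r (3 + n))
  where

  -- Solving the desired recurrence for b and substituting the system; stated without subtraction.
  b-closed : ∀ n → b (3 + n) + 9 * d n + 2 * r (2 + n) ≡ 3 * (r n + r (1 + n) + 2 * g n)
  b-closed zero rewrite b₃ | d₀ | r₂ | r₀ | r₁ | g₀ = refl
  b-closed (suc zero) rewrite b₄ | d-suc 0 | d₀ | g-suc 0 | g₀ | d₀ | r₀ | r₁ | r₂ | r₃ = refl
  -- `b-rec` has order two, hence the two base cases. The summand `c` supplies the terms that
  -- complete `2 * b (4 + n) + b (3 + n)` to the two earlier instances, and `r (2 + n)` for `b-rec`.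
  b-closed (suc (suc n)) = ℕ.+-cancelʳ-≡ c _ _ (begin
    b (5 + n) + 9 * d (2 + n) + 2 * r (4 + n) + c
      ≡⟨ regroup (b (5 + n)) (d n) (d (1 + n)) (d (2 + n)) (r (2 + n)) (r (3 + n)) (r (4 + n)) ⟩
    (b (5 + n) + r (2 + n)) + rest
      ≡⟨ cong (_+ rest) (b-rec n) ⟩
    (2 * b (4 + n) + b (3 + n) + r (3 + n)) + rest
      ≡⟨ regroup′ (b (3 + n)) (b (4 + n)) (d n) (d (1 + n)) (d (2 + n)) (r (2 + n)) (r (3 + n)) (r (4 + n)) ⟩
    2 * (b (4 + n) + 9 * d (1 + n) + 2 * r (3 + n)) + (b (3 + n) + 9 * d n + 2 * r (2 + n)) + top
      ≡⟨ cong₂ (λ p q → 2 * p + q + top) (b-closed (suc n)) (b-closed n) ⟩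
    2 * (3 * (r (1 + n) + r (2 + n) + 2 * g (1 + n))) + 3 * (r n + r (1 + n) + 2 * g n) + top
      ≡⟨ system ⟩
    3 * (r (2 + n) + r (3 + n) + 2 * g (2 + n)) + c ∎)
    where
    open ≡-Reasoning
    c rest top : ℕ
    c = r (2 + n) + 18 * d (1 + n) + 4 * r (3 + n) + 9 * d n + 2 * r (2 + n)
    rest = 18 * d (1 + n) + 4 * r (3 + n) + 9 * d n + 2 * r (2 + n) + 9 * d (2 + n) + 2 * r (4 + n)
    top = r (3 + n) + 9 * d (2 + n) + 2 * r (4 + n)
    regroup : ∀ b₅ d₀ d₁ d₂ r₂ r₃ r₄ →
      b₅ + 9 * d₂ + 2 * r₄ + (r₂ + 18 * d₁ + 4 * r₃ + 9 * d₀ + 2 * r₂) ≡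
      (b₅ + r₂) + (18 * d₁ + 4 * r₃ + 9 * d₀ + 2 * r₂ + 9 * d₂ + 2 * r₄)
    regroup = solve-∀
    regroup′ : ∀ b₃ b₄ d₀ d₁ d₂ r₂ r₃ r₄ →
      (2 * b₄ + b₃ + r₃) + (18 * d₁ + 4 * r₃ + 9 * d₀ + 2 * r₂ + 9 * d₂ + 2 * r₄) ≡
      2 * (b₄ + 9 * d₁ + 2 * r₃) + (b₃ + 9 * d₀ + 2 * r₂) + (r₃ + 9 * d₂ + 2 * r₄)
    regroup′ = solve-∀
    identity : ∀ r₀ r₁ r₂ u₀ g₀ d₀ g₁ d₁ → g₁ ≡ 4 * g₀ + d₀ + 3 * r₀ → d₁ ≡ 2 * d₀ + g₀ + r₀ →
      2 * (3 * (r₁ + r₂ + 2 * g₁)) + 3 * (r₀ + r₁ + 2 * g₀) +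
        (6 * u₀ + 9 * (2 * d₁ + g₁ + r₁) + 2 * (6 * (3 * u₀ + 2 * d₀ + (r₀ + g₀)))) ≡
      3 * (r₂ + 6 * u₀ + 2 * (4 * g₁ + d₁ + 3 * r₁)) + (r₂ + 18 * d₁ + 4 * (6 * u₀) + 9 * d₀ + 2 * r₂)
    identity r₀ r₁ r₂ u₀ g₀ d₀ _ _ refl refl = polynomial r₀ r₁ r₂ u₀ g₀ d₀
      where
      polynomial : ∀ r₀ r₁ r₂ u₀ g₀ d₀ →
        2 * (3 * (r₁ + r₂ + 2 * (4 * g₀ + d₀ + 3 * r₀))) + 3 * (r₀ + r₁ + 2 * g₀) +
          (6 * u₀ + 9 * (2 * (2 * d₀ + g₀ + r₀) + (4 * g₀ + d₀ + 3 * r₀) + r₁) +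
            2 * (6 * (3 * u₀ + 2 * d₀ + (r₀ + g₀)))) ≡
        3 * (r₂ + 6 * u₀ + 2 * (4 * (4 * g₀ + d₀ + 3 * r₀) + (2 * d₀ + g₀ + r₀) + 3 * r₁)) +
          (r₂ + 18 * (2 * d₀ + g₀ + r₀) + 4 * (6 * u₀) + 9 * d₀ + 2 * r₂)
      polynomial = solve-∀
    system : 2 * (3 * (r (1 + n) + r (2 + n) + 2 * g (1 + n))) + 3 * (r n + r (1 + n) + 2 * g n) + top ≡
             3 * (r (2 + n) + r (3 + n) + 2 * g (2 + n)) + c
    system rewrite r-suc³ (1 + n) | r-suc³ n | u-suc n | g-suc (1 + n) | d-suc (1 + n) =
      identity (r n) (r (1 + n)) (r (2 + n)) (u n) (g n) (d n) (g (1 + n)) (d (1 + n)) (g-suc n) (d-suc n)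

  r-rec : ∀ n → r (5 + n) + 12 * r (3 + n) ≡ 7 * r (4 + n) + 4 * r (2 + n) + 2 * b (3 + n)
  -- Adding `18 * d n` completes the terms in `b (3 + n)` and `r (2 + n)` to twice the left side of
  -- `b-closed`.
  r-rec n = ℕ.+-cancelʳ-≡ (18 * d n) _ _ (begin
    r (5 + n) + 12 * r (3 + n) + 18 * d n
      ≡⟨ system ⟩
    7 * r (4 + n) + 2 * (3 * (r n + r (1 + n) + 2 * g n))
      ≡⟨ cong (λ q → 7 * r (4 + n) + 2 * q) (b-closed n) ⟨
    7 * r (4 + n) + 2 * (b (3 + n) + 9 * d n + 2 * r (2 + n))
      ≡⟨ regroup (b (3 + n)) (d n) (r (2 + n)) (r (4 + n)) ⟩
    7 * r (4 + n) + 4 * r (2 + n) + 2 * b (3 + n) + 18 * d n ∎)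
    where
    open ≡-Reasoning
    identity : ∀ r₀ r₁ u₀ g₀ d₀ →
      6 * (3 * (3 * u₀ + 2 * d₀ + (r₀ + g₀)) + 2 * (2 * d₀ + g₀ + r₀) + (r₁ + (4 * g₀ + d₀ + 3 * r₀))) +
        12 * (6 * u₀) + 18 * d₀ ≡
      7 * (6 * (3 * u₀ + 2 * d₀ + (r₀ + g₀))) + 2 * (3 * (r₀ + r₁ + 2 * g₀))
    identity = solve-∀
    regroup : ∀ b₃ d₀ r₂ r₄ → 7 * r₄ + 2 * (b₃ + 9 * d₀ + 2 * r₂) ≡ 7 * r₄ + 4 * r₂ + 2 * b₃ + 18 * d₀
    regroup = solve-∀
    system : r (5 + n) + 12 * r (3 + n) + 18 * d n ≡ 7 * r (4 + n) + 2 * (3 * (r n + r (1 + n) + 2 * g n))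
    system rewrite r-suc³ (2 + n) | r-suc³ (1 + n) | r-suc³ n | u-suc (1 + n) | u-suc n | g-suc n | d-suc n =
      identity (r n) (r (1 + n)) (u n) (g n) (d n)

sum2to-suc : ∀ b m → sum2to b (2 + m) ≡ sum2to b (1 + m) + b (2 + m)
sum2to-suc b m = begin
  sum (map (λ k → b (2 + k)) (upTo (suc m)))
    ≡⟨ cong (sum ∘ map (λ k → b (2 + k))) (upTo-∷ʳ m) ⟨
  sum (map (λ k → b (2 + k)) (upTo m ++ m ∷ []))
    ≡⟨ cong sum (map-++ (λ k → b (2 + k)) (upTo m) (m ∷ [])) ⟩
  sum (map (λ k → b (2 + k)) (upTo m) ++ b (2 + m) ∷ [])
    ≡⟨ sum-++ (map (λ k → b (2 + k)) (upTo m)) _ ⟩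
  sum2to b (1 + m) + (b (2 + m) + 0)
    ≡⟨ cong (_+_ (sum2to b (1 + m))) (ℕ.+-identityʳ _) ⟩
  sum2to b (1 + m) + b (2 + m) ∎
  where open ≡-Reasoning

integral : ∀ p q r s t → p + 12 * r ≡ 7 * q + 4 * s + 2 * t →
  + p ≡ ((+ 7 *ℤ + q -ℤ + 12 *ℤ + r) +ℤ + 4 *ℤ + s) +ℤ + 2 *ℤ + t
integral p q r s t eq = begin
  + p                                          ≡⟨ add-sub (+ p) (+ 12 *ℤ + r) ⟩
  (+ p +ℤ + 12 *ℤ + r) -ℤ + 12 *ℤ + r          ≡⟨ cong (_-ℤ + 12 *ℤ + r) lifted ⟩
  (+ 7 *ℤ + q +ℤ + 4 *ℤ + s +ℤ + 2 *ℤ + t) -ℤ + 12 *ℤ + r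
                                               ≡⟨ shuffle (+ 7 *ℤ + q) (+ 12 *ℤ + r) (+ 4 *ℤ + s) (+ 2 *ℤ + t) ⟩
  ((+ 7 *ℤ + q -ℤ + 12 *ℤ + r) +ℤ + 4 *ℤ + s) +ℤ + 2 *ℤ + t ∎
  where
  open ≡-Reasoning
  add-sub : ∀ x y → x ≡ (x +ℤ y) -ℤ y
  add-sub = ℤ-Solver.solve-∀
  shuffle : ∀ w x y z → (w +ℤ y +ℤ z) -ℤ x ≡ ((w -ℤ x) +ℤ y) +ℤ z
  shuffle = ℤ-Solver.solve-∀
  lifted : + p +ℤ + 12 *ℤ + r ≡ + 7 *ℤ + q +ℤ + 4 *ℤ + s +ℤ + 2 *ℤ + t
  lifted rewrite sym (ℤ.pos-* 12 r) | sym (ℤ.pos-* 7 q) | sym (ℤ.pos-* 4 s) | sym (ℤ.pos-* 2 t) = cong +_ eq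

-- Application to the counting sequence

-- The finite check evaluates the automaton through `root` instead of enumerating permutations.
a-small : ∀ n → n ≤ 4 → a n ≡ n !
a-small n n≤4 = trans (a≡root n) (root-small n n≤4)
  where
  root-small : ∀ n → n ≤ 4 → root n ≡ n !
  root-small 0 _ = refl
  root-small 1 _ = refl
  root-small 2 _ = refl
  root-small 3 _ = refl
  root-small 4 _ = refl
  root-small (suc (suc (suc (suc (suc _))))) (s≤s (s≤s (s≤s (s≤s ()))))

a-suc³ : ∀ n → a (3 + n) ≡ 6 * fourOnes n
a-suc³ n = trans (a≡root (3 + n)) (root-suc³ n)

fourOnes-suc-a : ∀ n → fourOnes (suc n) ≡ 3 * fourOnes n + 2 * gap n + (a n + gain₃ n)
fourOnes-suc-a n = trans (fourOnes-suc n)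
  (cong (λ r → 3 * fourOnes n + 2 * gap n + (r + gain₃ n)) (sym (a≡root n)))

gain₃-suc-a : ∀ n → gain₃ (suc n) ≡ 4 * gain₃ n + gap n + 3 * a n
gain₃-suc-a n = trans (gain₃-suc n) (cong (λ r → 4 * gain₃ n + gap n + 3 * r) (sym (a≡root n)))

gap-suc-a : ∀ n → gap (suc n) ≡ 2 * gap n + gain₃ n + a n
gap-suc-a n = trans (gap-suc n) (cong (_+_ (2 * gap n + gain₃ n)) (sym (a≡root n)))

theorem7 : (b : ℕ → ℕ) → b 1 ≡ 0 → b 2 ≡ 1
    → (∀ n → 3 ≤ n → b n ≡ a (n Data.Nat.∸ 2) + b (n Data.Nat.∸ 1) + 2 * sum2to b (n Data.Nat.∸ 2))
    → (∀ n → n ≤ 4 → a n ≡ n !)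
    × (∀ n → 5 ≤ n → + a n ≡ (((+ 7 *ℤ + a (n Data.Nat.∸ 1)) -ℤ (+ 12 *ℤ + a (n Data.Nat.∸ 2))) +ℤ (+ 4 *ℤ + a (n Data.Nat.∸ 3))) +ℤ (+ 2 *ℤ + b (n Data.Nat.∸ 2)))
theorem7 b b₁ b₂ b-def = a-small , large
  where
  b-suc³ : ∀ n → b (3 + n) ≡ a (1 + n) + b (2 + n) + 2 * sum2to b (1 + n)
  b-suc³ n = b-def (3 + n) (s≤s (s≤s (s≤s z≤n)))

  b₃ : b 3 ≡ 2
  b₃ = trans (b-suc³ 0) (cong₂ (λ x y → x + y + 0) (a-small 1 (s≤s z≤n)) b₂)

  b₄ : b 4 ≡ 6
  b₄ = trans (b-suc³ 1) (trans (cong₂ (λ x y → x + y + 2 * (b 2 + 0)) (a-small 2 (s≤s (s≤s z≤n))) b₃)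
                               (cong (λ x → 4 + 2 * (x + 0)) b₂))

  -- Comparing the definitions of `b (5 + n)` and `b (4 + n)` removes the sum; `a (2 + n)` stands on
  -- the left to avoid subtraction.
  b-rec : ∀ n → b (5 + n) + a (2 + n) ≡ 2 * b (4 + n) + b (3 + n) + a (3 + n)
  b-rec n = begin
    b (5 + n) + a (2 + n)
      ≡⟨ cong (_+ a (2 + n)) (b-suc³ (2 + n)) ⟩
    a (3 + n) + b (4 + n) + 2 * sum2to b (3 + n) + a (2 + n)
      ≡⟨ cong (λ S → a (3 + n) + b (4 + n) + 2 * S + a (2 + n)) (sum2to-suc b (1 + n)) ⟩
    a (3 + n) + b (4 + n) + 2 * (sum2to b (2 + n) + b (3 + n)) + a (2 + n)
      ≡⟨ regroup (a (2 + n)) (a (3 + n)) (b (3 + n)) (b (4 + n)) (sum2to b (2 + n)) ⟩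
    b (4 + n) + (a (2 + n) + b (3 + n) + 2 * sum2to b (2 + n)) + b (3 + n) + a (3 + n)
      ≡⟨ cong (λ x → b (4 + n) + x + b (3 + n) + a (3 + n)) (b-suc³ (1 + n)) ⟨
    b (4 + n) + b (4 + n) + b (3 + n) + a (3 + n)
      ≡⟨ cong (λ x → b (4 + n) + x + b (3 + n) + a (3 + n)) (ℕ.+-identityʳ (b (4 + n))) ⟨
    2 * b (4 + n) + b (3 + n) + a (3 + n) ∎
    where
    open ≡-Reasoning
    regroup : ∀ r₂ r₃ x y S → r₃ + y + 2 * (S + x) + r₂ ≡ y + (r₂ + x + 2 * S) + x + r₃
    regroup = solve-∀

  open LinearSystem a fourOnes gain₃ gap a-suc³ fourOnes-suc-a gain₃-suc-a gap-suc-a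
    (a-small 0 z≤n) (a-small 1 (s≤s z≤n)) (a-small 2 (s≤s (s≤s z≤n))) (a-small 3 (s≤s (s≤s (s≤s z≤n)))) refl refl
    b b₃ b₄ b-rec

  large : ∀ n → 5 ≤ n →
    + a n ≡ (((+ 7 *ℤ + a (n Data.Nat.∸ 1)) -ℤ (+ 12 *ℤ + a (n Data.Nat.∸ 2))) +ℤ (+ 4 *ℤ + a (n Data.Nat.∸ 3)))
              +ℤ (+ 2 *ℤ + b (n Data.Nat.∸ 2))
  -- Matching on `5 ≤ n` exposes five successors, so the truncated subtractions compute.
  large _ (s≤s (s≤s (s≤s (s≤s (s≤s {n = n} z≤n))))) =
    integral (a (5 + n)) (a (4 + n)) (a (3 + n)) (a (2 + n)) (b (3 + n)) (r-rec n)
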